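{- Let $G = (V = V_1 \cup V_2 \cup V_3, E, w)$ be a 3-layered DAG with positive edge weights and $|V_2| = 3$. Then there is an additive triple of DAGs $(G_1^*, G_2^*, G_3^*)$ with $G_i^* = (V^*, E_i^*)$ such that: (1) $|V^*| = |V_1| + |V_3|$; (2) $|E_1^*| + |E_2^*| + |E_3^*| = 2 \cdot |V_1| \cdot |V_3|$; (3) $$\inf_{G' = (V, E, w')} \Big(\max_{e \in E} w'(e)\Big) \;\le\; 1 + \inf_{(h_1^*, h_2^*, h_3^*)} \mathrm{range}(h_1^*, h_2^*, h_3^*),$$ where the first infimum is over all gap-1 shortest-paths preservers $G' = (V, E, w')$ of $G$ and the second is over all 3-topological order preservers $(h_1^*, h_2^*, h_3^*)$ of $(G_1^*, G_2^*,G_3^*)$.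
   Context: Graphs are finite; the vertex set $V_1\cup V_3$ and the edge set $E$ are nonempty (so that the maxima are defined). A 3-layered DAG is a directed graph whose vertex set is a disjoint union $V_1 \cup V_2 \cup V_3$ and all of whose edges go from $V_1$ to $V_2$ or from $V_2$ to $V_3$. The weight of a path is the sum of its edge weights; a shortest path is a directed path of minimum weight between its endpoints. Given $G=(V,E,w)$, a graph $G'=(V,E,w')$ with positive real edge weights $w'$ is a gap-1 shortest-paths preserver of $G$ if (i) every shortest path in $G'$ is (as a sequence of vertices and edges) a shortest path in $G$, and (ii) for any shortest path $\pi$ in $G'$ and any path $\pi'$ with the same endpoints that is not a shortest path in $G'$, $w'(\pi)+1\le w'(\pi')$. For a DAG $(V^*,E^*)$, a topological ordering is a function $h:V^*\to\mathbb R$ with $h(u)+1\le h(v)$ for all $(u,v)\in E^*$. A triple of DAGs $G_i^*=(V^*,E_i^*)$, $i=1,2,3$, on the same vertex set is an additive triple if there exist topological orderings $h_i$ of $G_i^*$ with $h_1(v)+h_2(v)=h_3(v)$ for all $v\in V^*$; any such $(h_1,h_2,h_3)$ is called a 3-topological order preserver of the triple. Its range is $\mathrm{range}(h_1,h_2,h_3):=\max_{i\in\{1,2,3\}}\left(\max_{v\in V^*}h_i(v)-\min_{v\in V^*}h_i(v)\right)$. -}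

module Defs where

open import Algebra.Structures using (IsCommutativeRing)
open import Algebra.Properties.Monoid.Sum using (sum)
open import Data.Bool.Base using (Bool; T; if_then_else_)
open import Data.Fin.Base using (Fin; zero; suc)
open import Data.Nat.Base using (ℕ)
open import Data.Nat.Properties using (+-0-monoid)
open import Data.Product.Base using (Σ; ∃; _×_; _,_; proj₁; proj₂)
open import Relation.Binary.Construct.Closure.ReflexiveTransitive using (Star; ε; _◅_)
open import Relation.Binary.Construct.Closure.Transitive using (TransClosure)
open import Relation.Binary.Structures using (IsDecTotalOrder)
open import Relation.Nullary using (¬_)

module _ {A : Set} (_≤_ : A → A → Set) where

  IsUpperBound : (A → Set) → A → Set
  IsUpperBound P b = ∀ x → P x → x ≤ b

  IsLowerBound : (A → Set) → A → Set
  IsLowerBound P b = ∀ x → P x → b ≤ x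

  IsSupremum : (A → Set) → A → Set
  IsSupremum P s = IsUpperBound P s × (∀ b → IsUpperBound P b → s ≤ b)

  IsInfimum : (A → Set) → A → Set
  IsInfimum P i = IsLowerBound P i × (∀ b → IsLowerBound P b → b ≤ i)

-- The real numbers, axiomatised classically as a Dedekind-complete totally
-- ordered field, which determines them up to unique isomorphism.  Results are
-- proved for an arbitrary such field.  Decidability of the order and the
-- supremum axiom in this form are classical: they hold for the usual
-- constructions of ℝ under excluded middle.
record Reals : Set₁ where
  infix  4 _≈_ _≤_ _<_
  infixl 6 _+_ _-_
  infixl 7 _*_
  infix  8 -_
  field
    Carrier           : Set
    _≈_ _≤_           : Carrier → Carrier → Set
    _+_ _*_           : Carrier → Carrier → Carrier
    -_                : Carrier → Carrier
    0# 1#             : Carrier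
    isCommutativeRing : IsCommutativeRing _≈_ _+_ _*_ -_ 0# 1#
    isDecTotalOrder   : IsDecTotalOrder _≈_ _≤_
    0≉1               : ¬ (0# ≈ 1#)
    inverse           : ∀ x → ¬ (x ≈ 0#) → ∃ λ y → x * y ≈ 1#
    +-monoˡ-≤         : ∀ z {x y} → x ≤ y → x + z ≤ y + z
    *-nonNeg          : ∀ {x y} → 0# ≤ x → 0# ≤ y → 0# ≤ x * y
    supremum          : ∀ (P : Carrier → Set) → ∃ P → ∃ (IsUpperBound _≤_ P) →
                        ∃ (IsSupremum _≤_ P)

  _-_ : Carrier → Carrier → Carrier
  x - y = x + (- y)

  _<_ : Carrier → Carrier → Set
  x < y = x ≤ y × ¬ (x ≈ y)

-- Given by the indicator function of the edge set E ⊆ V × V.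
Digraph : Set → Set
Digraph V = V → V → Bool

Edge : ∀ {V} → Digraph V → V → V → Set
Edge G u v = T (G u v)

EdgeSet : ∀ {V} → Digraph V → Set
EdgeSet {V} G = Σ (V × V) λ (u , v) → Edge G u v

numEdges : ∀ {n} → Digraph (Fin n) → ℕ
numEdges G = sum +-0-monoid λ u → sum +-0-monoid λ v → if G u v then 1 else 0

-- Directed walks; in an acyclic graph these are exactly the directed paths.
Path : ∀ {V} → Digraph V → V → V → Set
Path G = Star (Edge G)

IsAcyclic : ∀ {V} → Digraph V → Set
IsAcyclic G = ∀ v → ¬ TransClosure (Edge G) v v

-- The disjoint union V₁ ∪ V₂ ∪ V₃ with |Vᵢ| = nᵢ.
data LayeredVertex (n₁ n₂ n₃ : ℕ) : Set where
  in₁ : Fin n₁ → LayeredVertex n₁ n₂ n₃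
  in₂ : Fin n₂ → LayeredVertex n₁ n₂ n₃
  in₃ : Fin n₃ → LayeredVertex n₁ n₂ n₃

data ConsecutiveLayers {n₁ n₂ n₃ : ℕ} :
     LayeredVertex n₁ n₂ n₃ → LayeredVertex n₁ n₂ n₃ → Set where
  1→2 : ∀ {i j} → ConsecutiveLayers (in₁ i) (in₂ j)
  2→3 : ∀ {j k} → ConsecutiveLayers (in₂ j) (in₃ k)

IsThreeLayered : ∀ {n₁ n₂ n₃} → Digraph (LayeredVertex n₁ n₂ n₃) → Set
IsThreeLayered G = ∀ u v → Edge G u v → ConsecutiveLayers u v

module _ (ℝ : Reals) where
  open Reals ℝ

  IsMaximum : {I : Set} → (I → Carrier) → Carrier → Set
  IsMaximum f x = (∃ λ i → f i ≈ x) × (∀ i → f i ≤ x)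

  IsMinimum : {I : Set} → (I → Carrier) → Carrier → Set
  IsMinimum f x = (∃ λ i → f i ≈ x) × (∀ i → x ≤ f i)

  IsInf : (Carrier → Set) → Carrier → Set
  IsInf = IsInfimum _≤_

  module _ {V : Set} (G : Digraph V) where

    Weighting : Set
    Weighting = EdgeSet G → Carrier

    IsPositive : Weighting → Set
    IsPositive w = ∀ e → 0# < w e

    weight : Weighting → ∀ {u v} → Path G u v → Carrier
    weight w ε                   = 0#
    weight w (_◅_ {u} {v} uv π) = w ((u , v) , uv) + weight w π

    IsShortest : Weighting → ∀ {u v} → Path G u v → Set
    IsShortest w {u} {v} π = ∀ (π′ : Path G u v) → weight w π ≤ weight w π′

    record IsGap1Preserver (w w′ : Weighting) : Set where
      field
        positive  : IsPositive w′
        preserves : ∀ {u v} (π : Path G u v) → IsShortest w′ π → IsShortest w π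
        gap       : ∀ {u v} (π π′ : Path G u v) →
                    IsShortest w′ π → ¬ IsShortest w′ π′ →
                    weight w′ π + 1# ≤ weight w′ π′

    PreserverMaxWeight : Weighting → Carrier → Set
    PreserverMaxWeight w x = ∃ λ w′ → IsGap1Preserver w w′ × IsMaximum w′ x

    IsTopologicalOrdering : (V → Carrier) → Set
    IsTopologicalOrdering h = ∀ u v → Edge G u v → h u + 1# ≤ h v

  -- The three graphs, and the three orderings, are indexed by Fin 3.
  module _ {V : Set} (G : Fin 3 → Digraph V) where

    IsOrderPreserver : (Fin 3 → V → Carrier) → Set
    IsOrderPreserver h =
      (∀ i → IsTopologicalOrdering (G i) (h i)) ×
      (∀ v → h zero v + h (suc zero) v ≈ h (suc (suc zero)) v)

    IsAdditiveTriple : Set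
    IsAdditiveTriple = (∀ i → IsAcyclic (G i)) × ∃ IsOrderPreserver

  IsSpread : {V : Set} → (V → Carrier) → Carrier → Set
  IsSpread h x = ∃ λ M → ∃ λ m → IsMaximum h M × IsMinimum h m × x ≈ M - m

  IsRange : {V : Set} → (Fin 3 → V → Carrier) → Carrier → Set
  IsRange h x = ∃ λ (s : Fin 3 → Carrier) → (∀ i → IsSpread (h i) (s i)) × IsMaximum s x

  OrderPreserverRange : {V : Set} → (Fin 3 → Digraph V) → Carrier → Set
  OrderPreserverRange G x = ∃ λ h → IsOrderPreserver G h × IsRange h x

{-# OPTIONS --safe #-}
module Submission where

open import Defs
open import Algebra.Bundles using (CommutativeRing)
open import Algebra.Solver.Ring.AlmostCommutativeRing
  using (fromCommutativeRing; _-Raw-AlmostCommutative⟶_)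
open import Data.Bool.Base using (Bool; false; T; if_then_else_)
open import Data.Bool.Properties using (T?; T-irrelevant)
open import Data.Fin.Base using (Fin; zero; suc; splitAt; join)
open import Data.Fin.Patterns using (0F; 1F; 2F)
import Data.Fin.Properties as Fin
open import Data.Integer.Base as ℤ using (ℤ; +_; -[1+_]; _⊖_)
import Data.Integer.Properties as ℤ
open import Data.List.Base using (List; []; _∷_; _++_; map; allFin; concatMap; cartesianProduct)
open import Data.List.Membership.Propositional using (_∈_; lose)
open import Data.List.Membership.Propositional.Properties
  using (∈-map⁺; ∈-++⁺ˡ; ∈-++⁺ʳ; ∈-allFin; ∈-concatMap⁺; ∈-cartesianProduct⁺)
import Data.List.Relation.Unary.All as All
open import Data.List.Relation.Unary.Any using (here)
import Data.Maybe.Base as Maybe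
open import Data.Nat.Base as ℕ using (ℕ; zero; suc)
import Data.Nat.Properties as ℕ
open import Algebra.Properties.CommutativeMonoid.Sum ℕ.+-0-commutativeMonoid
  using (sum; sum-cong-≗; sum-replicate-zero; ∑-distrib-+; ∑-comm)
open import Data.Product.Base using (∃; Σ-syntax; ∃-syntax; _×_; _,_; proj₁; proj₂)
open import Data.Sum.Base as Sum using (_⊎_; inj₁; inj₂; fromInj₁)
open import Function.Base using (_∘_)
open import Level using (0ℓ)
open import Relation.Binary.Bundles using (DecTotalOrder)
open import Relation.Binary.Construct.Closure.ReflexiveTransitive using (ε; _◅_)
open import Relation.Binary.Construct.Closure.Transitive using (TransClosure; [_]; _∷_)
open import Relation.Binary.PropositionalEquality as ≡ using (_≡_; _≢_)
open import Relation.Nullary using (¬_; yes; no; contradiction)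
open import Relation.Nullary.Decidable
  using (dec⇒maybe; decidable-stable; ⌊_⌋; toWitness; fromWitness)

-- A source and a target are joined by at most three routes, one per middle vertex,
-- and a choice win of the best route for each pair separates all of them by a gap of 1
-- iff the differences ψ v x − ψ v y of vertex potentials (the costs, negated at the
-- targets) satisfy one inequality for each pair and each y other than x = win.  For
-- the three pairs {x , y} these differences are three functions on V₁ ∪ V₃, one the
-- sum of the others, and the inequalities say precisely that they topologically order
-- three graphs, with two edges for each source and target.  Given such orderings,
-- shifting all weights at a vertex together turns the range into a bound on the weights.
-- Absent edges of G get a prohibitive cost, and ties are broken by perturbation.

-- A ring solver with integer coefficients for commutative rings

module IntegerCoefficientSolver (R : CommutativeRing 0ℓ 0ℓ) where
  open CommutativeRing R
  open import Algebra.Properties.Ring ring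
  open import Algebra.Properties.Semiring.Mult semiring using (×-homo-+; ×1-homo-*)
    renaming (_×_ to _·_)
  open import Relation.Binary.Reasoning.Setoid setoid

  -- The canonical ring homomorphism from the integers. Equality of integer coefficients is
  -- decidable, so normal forms can cancel them.
  ⟦_⟧ : ℤ → Carrier
  ⟦ + n ⟧      = n · 1#
  ⟦ -[1+ n ] ⟧ = - (suc n · 1#)

  -‿homo : ∀ i → ⟦ ℤ.- i ⟧ ≈ - ⟦ i ⟧
  -‿homo (+ zero)  = sym -0#≈0#
  -‿homo (+ suc n) = refl
  -‿homo -[1+ n ]  = sym (-‿involutive _)

  ⊖-homo : ∀ m n → ⟦ m ⊖ n ⟧ ≈ m · 1# - n · 1#
  ⊖-homo m       zero    = sym (trans (+-congˡ -0#≈0#) (+-identityʳ _))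
  ⊖-homo zero    (suc n) = sym (+-identityˡ _)
  ⊖-homo (suc m) (suc n) = begin
    ⟦ suc m ⊖ suc n ⟧                   ≡⟨ ≡.cong ⟦_⟧ (ℤ.[1+m]⊖[1+n]≡m⊖n m n) ⟩
    ⟦ m ⊖ n ⟧                           ≈⟨ ⊖-homo m n ⟩
    m · 1# - n · 1#                     ≈⟨ +-congʳ (xyx⁻¹≈y 1# _) ⟨
    (1# + m · 1# - 1#) - n · 1#         ≈⟨ +-assoc _ _ _ ⟩
    1# + m · 1# + (- 1# + - (n · 1#))   ≈⟨ +-congˡ (-‿+-comm _ _) ⟩
    suc m · 1# - suc n · 1#             ∎

  +-homo : ∀ i j → ⟦ i ℤ.+ j ⟧ ≈ ⟦ i ⟧ + ⟦ j ⟧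
  +-homo (+ m)    (+ n)    = ×-homo-+ 1# m n
  +-homo (+ m)    -[1+ n ] = ⊖-homo m (suc n)
  +-homo -[1+ m ] (+ n)    = trans (⊖-homo n (suc m)) (+-comm _ _)
  +-homo -[1+ m ] -[1+ n ] = begin
    - (suc (suc (m ℕ.+ n)) · 1#)        ≡⟨ ≡.cong (λ k → - (suc k · 1#)) (ℕ.+-suc m n) ⟨
    - ((suc m ℕ.+ suc n) · 1#)          ≈⟨ -‿cong (×-homo-+ 1# (suc m) (suc n)) ⟩
    - (suc m · 1# + suc n · 1#)         ≈⟨ -‿+-comm _ _ ⟨
    - (suc m · 1#) + - (suc n · 1#)     ∎

  -- A nonnegative second factor is treated first; in `*-homo` a negative one reduces to it by
  -- pulling out the sign.
  *-homo-+ : ∀ i n → ⟦ i ℤ.* + n ⟧ ≈ ⟦ i ⟧ * ⟦ + n ⟧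
  *-homo-+ (+ m)    n = begin
    ⟦ + m ℤ.* + n ⟧    ≡⟨ ≡.cong ⟦_⟧ (ℤ.pos-* m n) ⟨
    (m ℕ.* n) · 1#     ≈⟨ ×1-homo-* m n ⟩
    m · 1# * n · 1#    ∎
  *-homo-+ -[1+ m ] n = begin
    ⟦ -[1+ m ] ℤ.* + n ⟧          ≡⟨ ≡.cong ⟦_⟧ (ℤ.neg-distribˡ-* (+ suc m) (+ n)) ⟨
    ⟦ ℤ.- (+ suc m ℤ.* + n) ⟧     ≈⟨ -‿homo (+ suc m ℤ.* + n) ⟩
    - ⟦ + suc m ℤ.* + n ⟧         ≈⟨ -‿cong (*-homo-+ (+ suc m) n) ⟩
    - (suc m · 1# * n · 1#)       ≈⟨ -‿distribˡ-* _ _ ⟩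
    - (suc m · 1#) * n · 1#       ∎

  *-homo : ∀ i j → ⟦ i ℤ.* j ⟧ ≈ ⟦ i ⟧ * ⟦ j ⟧
  *-homo i (+ n)    = *-homo-+ i n
  *-homo i -[1+ n ] = begin
    ⟦ i ℤ.* -[1+ n ] ⟧         ≡⟨ ≡.cong ⟦_⟧ (ℤ.neg-distribʳ-* i (+ suc n)) ⟨
    ⟦ ℤ.- (i ℤ.* + suc n) ⟧    ≈⟨ -‿homo (i ℤ.* + suc n) ⟩
    - ⟦ i ℤ.* + suc n ⟧        ≈⟨ -‿cong (*-homo-+ i (suc n)) ⟩
    - (⟦ i ⟧ * suc n · 1#)     ≈⟨ -‿distribʳ-* _ _ ⟩
    ⟦ i ⟧ * - (suc n · 1#)     ∎

  morphism : ℤ.+-*-rawRing -Raw-AlmostCommutative⟶ fromCommutativeRing R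
  morphism = record
    { ⟦_⟧    = ⟦_⟧
    ; +-homo = +-homo
    ; *-homo = *-homo
    ; -‿homo = -‿homo
    ; 0-homo = refl
    ; 1-homo = +-identityʳ 1#
    }

  open import Algebra.Solver.Ring ℤ.+-*-rawRing (fromCommutativeRing R) morphism
    (λ i j → Maybe.map (λ i≡j → reflexive (≡.cong ⟦_⟧ i≡j)) (dec⇒maybe (i ℤ.≟ j)))
    public using (solve; con; _:=_; _:+_; _:-_; _:*_; :-_)

-- Ordered-field arithmetic and infima

module OrderedField (ℝ : Reals) where
  open Reals ℝ public

  commutativeRing : CommutativeRing 0ℓ 0ℓ
  commutativeRing = record { isCommutativeRing = isCommutativeRing }

  decTotalOrder : DecTotalOrder 0ℓ 0ℓ 0ℓ
  decTotalOrder = record { isDecTotalOrder = isDecTotalOrder }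

  open CommutativeRing commutativeRing public
    using (refl; sym; trans; reflexive; +-cong; +-congˡ; +-congʳ; +-comm; +-assoc;
           +-identityˡ; +-identityʳ; *-congˡ; -‿cong; setoid)
  open DecTotalOrder decTotalOrder public
    using (totalOrder; total; antisym; poset; _≟_)
    renaming (refl to ≤-refl; trans to ≤-trans; reflexive to ≤-reflexive)
  open IntegerCoefficientSolver commutativeRing public
    using (solve; con; _:=_; _:+_; _:-_; _:*_; :-_)
  module ≤-Reasoning where
    open import Relation.Binary.Reasoning.PartialOrder poset public

  +-mono-≤ : ∀ {x y u v} → x ≤ y → u ≤ v → x + u ≤ y + v
  +-mono-≤ {x} {y} {u} {v} x≤y u≤v = begin
    x + u  ≤⟨ +-monoˡ-≤ u x≤y ⟩
    y + u  ≈⟨ +-comm y u ⟩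
    u + y  ≤⟨ +-monoˡ-≤ y u≤v ⟩
    v + y  ≈⟨ +-comm v y ⟩
    y + v  ∎
    where open ≤-Reasoning

  -- The equation says u − v ≈ x − y, in a form without subtraction.
  ≤-transfer : ∀ {x y u v} → x ≤ y → x + v ≈ y + u → u ≤ v
  ≤-transfer {x} {y} {u} {v} x≤y x+v≈y+u = begin
    u            ≈⟨ solve 2 (λ u x → u := x :+ (u :- x)) refl u x ⟩
    x + (u - x)  ≤⟨ +-monoˡ-≤ (u - x) x≤y ⟩
    y + (u - x)  ≈⟨ +-assoc y u (- x) ⟨
    (y + u) - x  ≈⟨ +-congʳ x+v≈y+u ⟨
    (x + v) - x  ≈⟨ solve 2 (λ x v → (x :+ v) :- x := v) refl x v ⟩
    v            ∎
    where open ≤-Reasoning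

  -- If `1#` were at most `0#`, then `- 1#` would be nonnegative, and its square is `1#`.
  0≤1 : 0# ≤ 1#
  0≤1 with total 0# 1#
  ... | inj₁ 0≤1 = 0≤1
  ... | inj₂ 1≤0 = ≤-trans (*-nonNeg 0≤-1 0≤-1)
    (≤-reflexive (trans (solve 1 (λ i → (:- i) :* (:- i) := i :* i) refl 1#)
                        (CommutativeRing.*-identityˡ commutativeRing 1#)))
    where
    0≤-1 : 0# ≤ - 1#
    0≤-1 = ≤-transfer 1≤0 (solve 1 (λ i → i :+ (:- i) := con (+ 0) :+ con (+ 0)) refl 1#)

  x+1≰x : ∀ {x} → ¬ (x + 1# ≤ x)
  x+1≰x {x} x+1≤x = 0≉1 (antisym 0≤1
    (≤-transfer x+1≤x (solve 2 (λ x i → (x :+ i) :+ con (+ 0) := x :+ i) refl x 1#)))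

  ≤⇒≯ : ∀ {x y} → x ≤ y → ¬ (y < x)
  ≤⇒≯ x≤y (y≤x , y≉x) = y≉x (antisym y≤x x≤y)

  compare : ∀ x y → x < y ⊎ x ≈ y ⊎ y < x
  compare x y with x ≟ y | total x y
  ... | yes x≈y | _        = inj₂ (inj₁ x≈y)
  ... | no  x≉y | inj₁ x≤y = inj₁ (x≤y , x≉y)
  ... | no  x≉y | inj₂ y≤x = inj₂ (inj₂ (y≤x , λ y≈x → x≉y (sym y≈x)))

  ≮⇒≥ : ∀ {x y} → ¬ (x < y) → y ≤ x
  ≮⇒≥ {x} {y} x≮y with compare x y
  ... | inj₁ x<y              = contradiction x<y x≮y
  ... | inj₂ (inj₁ x≈y)       = ≤-reflexive (sym x≈y)
  ... | inj₂ (inj₂ (y≤x , _)) = y≤x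

  <-≤-trans : ∀ {x y z} → x < y → y ≤ z → x < z
  <-≤-trans (x≤y , x≉y) y≤z =
    ≤-trans x≤y y≤z , λ x≈z → x≉y (antisym x≤y (≤-trans y≤z (≤-reflexive (sym x≈z))))

  1≤⇒0< : ∀ {x} → 1# ≤ x → 0# < x
  1≤⇒0< = <-≤-trans (0≤1 , 0≉1)

  0<x+y : ∀ {x y} → 0# < x → 0# ≤ y → 0# < x + y
  0<x+y {x} {y} 0<x 0≤y = <-≤-trans 0<x (begin
    x        ≈⟨ +-identityʳ x ⟨
    x + 0#   ≤⟨ +-mono-≤ ≤-refl 0≤y ⟩
    x + y    ∎)
    where open ≤-Reasoning

  *-monoˡ-≤ : ∀ {x y} z → 0# ≤ z → x ≤ y → x * z ≤ y * z
  *-monoˡ-≤ {x} {y} z 0≤z x≤y = ≤-transfer (*-nonNeg 0≤y-x 0≤z)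
    (solve 3 (λ x y z → con (+ 0) :+ y :* z := (y :- x) :* z :+ x :* z) refl x y z)
    where
    0≤y-x : 0# ≤ y - x
    0≤y-x = ≤-transfer x≤y (solve 2 (λ x y → x :+ (y :- x) := y :+ con (+ 0)) refl x y)

  -- `k` is the quotient of `c` by `d`. Stability under enlarging `l` lets one factor serve finitely
  -- many comparisons, and positivity of `d` is assumed only after `k` is fixed, so that a `k`
  -- exists for every pair compared.
  multiple-≥ : ∀ c d → ∃ λ k → ∀ {l} → k ≤ l → 0# < d → c ≤ l * d
  multiple-≥ c d with d ≟ 0#
  ... | yes d≈0 = 0# , λ { _ (_ , 0≉d) → contradiction (sym d≈0) 0≉d }
  ... | no  d≉0 with d⁻¹ , dd⁻¹≈1 ← inverse d d≉0 = c * d⁻¹ , λ {l} cd⁻¹≤l (0≤d , _) → begin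
    c                ≈⟨ CommutativeRing.*-identityʳ commutativeRing c ⟨
    c * 1#           ≈⟨ *-congˡ dd⁻¹≈1 ⟨
    c * (d * d⁻¹)    ≈⟨ solve 3 (λ c d e → c :* (d :* e) := c :* e :* d) refl c d d⁻¹ ⟩
    c * d⁻¹ * d      ≤⟨ *-monoˡ-≤ d 0≤d cd⁻¹≤l ⟩
    l * d            ∎
    where open ≤-Reasoning

  <⇒0<- : ∀ {x y} → x < y → 0# < y - x
  <⇒0<- {x} {y} (x≤y , x≉y) =
    ≤-transfer x≤y (solve 2 (λ x y → x :+ (y :- x) := y :+ con (+ 0)) refl x y) ,
    λ 0≈y-x → x≉y (begin
      x              ≈⟨ +-identityˡ x ⟨
      0# + x         ≈⟨ +-congʳ 0≈y-x ⟩
      (y - x) + x    ≈⟨ solve 2 (λ x y → (y :- x) :+ x := y) refl x y ⟩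
      y              ∎)
    where open import Relation.Binary.Reasoning.Setoid setoid

  -- The infimum is the supremum of the set of lower bounds.
  infimum : (P : Carrier → Set) → ∃ P → ∃ (IsLowerBound _≤_ P) → ∃ (IsInf ℝ P)
  infimum P (x , Px) bounded
    with i , upper , least ← supremum (IsLowerBound _≤_ P) bounded (x , λ _ lower → lower x Px)
    = i , (λ y Py → least y λ _ lower → lower y Py) , upper

  -- Every element of `Q` lies above `a - c`, because `a` bounds the matching element of `P` from
  -- below; so `a - c` is at most the infimum of `Q`.
  infimum-≤ : ∀ {P Q : Carrier → Set} c →
    ∃ Q → ∃ (IsLowerBound _≤_ P) → ∃ (IsLowerBound _≤_ Q) →
    (∀ y → Q y → ∃ λ x → P x × x ≤ c + y) →
    ∃[ a ] ∃[ b ] IsInf ℝ P a × IsInf ℝ Q b × a ≤ c + b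
  infimum-≤ {P} {Q} c (y , Qy) P-bounded Q-bounded Q⇒P
    with x , Px , _ ← Q⇒P y Qy
    with a , infP ← infimum P (x , Px) P-bounded
       | b , infQ ← infimum Q (y , Qy) Q-bounded
    = a , b , infP , infQ , ≤-transfer (proj₂ infQ (a - c) a-c-lower)
        (solve 3 (λ a b c → (a :- c) :+ (c :+ b) := b :+ a) refl a b c)
    where
    a-c-lower : IsLowerBound _≤_ Q (a - c)
    a-c-lower y Qy = let x , Px , x≤c+y = Q⇒P y Qy in
      ≤-transfer (≤-trans (proj₁ infP x Px) x≤c+y)
        (solve 3 (λ a y c → a :+ y := (c :+ y) :+ (a :- c)) refl a y c)

-- Enumerations and extrema of finite families

Enumerable : Set → Set
Enumerable I = Σ[ xs ∈ List I ] ∀ i → i ∈ xs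

enumFin : ∀ n → Enumerable (Fin n)
enumFin n = allFin n , ∈-allFin

enum× : ∀ {I J} → Enumerable I → Enumerable J → Enumerable (I × J)
enum× (xs , ∈xs) (ys , ∈ys) =
  cartesianProduct xs ys , λ (i , j) → ∈-cartesianProduct⁺ (∈xs i) (∈ys j)

enumLayeredVertex : ∀ n₁ n₂ n₃ → Enumerable (LayeredVertex n₁ n₂ n₃)
enumLayeredVertex n₁ n₂ n₃ = l₁ ++ l₂ ++ l₃ , λ where
    (in₁ i) → ∈-++⁺ˡ (∈-map⁺ in₁ (∈-allFin i))
    (in₂ j) → ∈-++⁺ʳ l₁ (∈-++⁺ˡ (∈-map⁺ in₂ (∈-allFin j)))
    (in₃ k) → ∈-++⁺ʳ l₁ (∈-++⁺ʳ l₂ (∈-map⁺ in₃ (∈-allFin k)))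
  where
  l₁ l₂ l₃ : List (LayeredVertex n₁ n₂ n₃)
  l₁ = map in₁ (allFin n₁)
  l₂ = map in₂ (allFin n₂)
  l₃ = map in₃ (allFin n₃)

enumEdgeSet : ∀ {V} (G : Digraph V) → Enumerable V → Enumerable (EdgeSet G)
enumEdgeSet {V} G enumV with pairs , ∈pairs ← enum× enumV enumV =
  concatMap edges pairs ,
  λ (uv , e) → ∈-concatMap⁺ edges (lose (∈pairs uv) (∈edges uv e))
  where
  edges : V × V → List (EdgeSet G)
  edges (u , v) with T? (G u v)
  ... | yes e = ((u , v) , e) ∷ []
  ... | no  _ = []

  ∈edges : ∀ uv (e : Edge G (proj₁ uv) (proj₂ uv)) → (uv , e) ∈ edges uv
  ∈edges (u , v) e with T? (G u v)
  ... | yes e′ = here (≡.cong ((u , v) ,_) (T-irrelevant e e′))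
  ... | no  ¬e = contradiction e ¬e

module Extrema (ℝ : Reals) where
  open OrderedField ℝ
  open import Data.List.Extrema totalOrder
    using (argmin; argmax; max; f[argmin]≤f[xs]; f[xs]≤f[argmax]; xs≤max)

  minimiser : ∀ {I} → Enumerable I → I → (f : I → Carrier) → ∃ λ i → ∀ j → f i ≤ f j
  minimiser (xs , ∈xs) i f =
    argmin f i xs , λ j → All.lookup (f[argmin]≤f[xs] i xs) (∈xs j)

  maximiser : ∀ {I} → Enumerable I → I → (f : I → Carrier) → ∃ λ i → ∀ j → f j ≤ f i
  maximiser (xs , ∈xs) i f =
    argmax f i xs , λ j → All.lookup (f[xs]≤f[argmax] i xs) (∈xs j)

  maximum : ∀ {I} → Enumerable I → I → (f : I → Carrier) → ∃ (IsMaximum ℝ f)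
  maximum enum i f with j , f≤fj ← maximiser enum i f = f j , (j , refl) , f≤fj

  minimum : ∀ {I} → Enumerable I → I → (f : I → Carrier) → ∃ (IsMinimum ℝ f)
  minimum enum i f with j , fj≤f ← minimiser enum i f = f j , (j , refl) , fj≤f

  upperBound : ∀ {I} → Enumerable I → (f : I → Carrier) → ∃ λ b → ∀ i → f i ≤ b
  upperBound (xs , ∈xs) f =
    -- The default `0#` provides a bound even when `I` is empty, as happens if one outer layer is
    -- empty.
    max 0# (map f xs) , λ i → All.lookup (xs≤max 0# (map f xs)) (∈-map⁺ f (∈xs i))

-- Pairs of middle vertices and separating costs

-- Graph number i compares the middle vertices lo i and hi i.
lo hi : Fin 3 → Fin 3
lo 0F = 0F
lo 1F = 1F
lo 2F = 0F
hi 0F = 1F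
hi 1F = 2F
hi 2F = 2F

lo≢hi : ∀ i → lo i ≢ hi i
lo≢hi 0F ()
lo≢hi 1F ()
lo≢hi 2F ()

≢⇒pair : ∀ {x y} → x ≢ y →
         ∃ λ i → (x ≡ lo i × y ≡ hi i) ⊎ (x ≡ hi i × y ≡ lo i)
≢⇒pair {0F} {0F} x≢x = contradiction ≡.refl x≢x
≢⇒pair {0F} {1F} _   = 0F , inj₁ (≡.refl , ≡.refl)
≢⇒pair {0F} {2F} _   = 2F , inj₁ (≡.refl , ≡.refl)
≢⇒pair {1F} {0F} _   = 0F , inj₂ (≡.refl , ≡.refl)
≢⇒pair {1F} {1F} x≢x = contradiction ≡.refl x≢x
≢⇒pair {1F} {2F} _   = 1F , inj₁ (≡.refl , ≡.refl)
≢⇒pair {2F} {0F} _   = 2F , inj₂ (≡.refl , ≡.refl)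
≢⇒pair {2F} {1F} _   = 1F , inj₂ (≡.refl , ≡.refl)
≢⇒pair {2F} {2F} x≢x = contradiction ≡.refl x≢x

module Separation (ℝ : Reals) {n₁ n₃ : ℕ} where
  open OrderedField ℝ
  open Extrema ℝ

  -- The winner is a variable `x` with an equation, so that `≢⇒pair` can later unify it with `lo i`
  -- or `hi i`.
  Separates : (Fin n₁ → Fin n₃ → Fin 3) →
              (Fin n₁ → Fin 3 → Carrier) → (Fin n₃ → Fin 3 → Carrier) → Set
  Separates win p q = ∀ s t {x y} → win s t ≡ x → x ≢ y → (p s x + q t x) + 1# ≤ p s y + q t y

  module _ (p : Fin n₁ → Fin 3 → Carrier) (q : Fin n₃ → Fin 3 → Carrier) where

    cost : Fin n₁ → Fin n₃ → Fin 3 → Carrier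
    cost s t x = p s x + q t x

    handicap : Fin 3 → Carrier
    handicap 0F = 0#
    handicap 1F = 1#
    handicap 2F = 1# + 1#

    handicap-step : ∀ i → handicap (lo i) + 1# ≤ handicap (hi i)
    handicap-step 0F = ≤-reflexive (+-identityˡ 1#)
    handicap-step 1F = ≤-refl
    handicap-step 2F = +-monoˡ-≤ 1# 0≤1

    0≤handicap : ∀ x → 0# ≤ handicap x
    0≤handicap 0F = ≤-refl
    0≤handicap 1F = 0≤1
    0≤handicap 2F = ≤-trans 0≤1 (≤-trans (≤-reflexive (sym (+-identityˡ 1#))) (+-monoˡ-≤ 1# 0≤1))

    handicap≤2 : ∀ x → handicap x ≤ 1# + 1#
    handicap≤2 0F = 0≤handicap 2F
    handicap≤2 1F = ≤-trans (≤-reflexive (sym (+-identityˡ 1#))) (+-monoˡ-≤ 1# 0≤1)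
    handicap≤2 2F = ≤-refl

    -- Scale the costs until distinct ones differ by at least 3, so that adding the
    -- handicaps 0, 1, 2 breaks the ties without affecting strict comparisons.
    separate : ∃[ win ] ∃[ p′ ] ∃[ q′ ]
      (∀ s t y → cost s t (win s t) ≤ cost s t y) × Separates win p′ q′
    separate = win , p′ , q′ , cost-win , separates
      where
      Comparison : Set
      Comparison = (Fin n₁ × Fin n₃) × (Fin 3 × Fin 3)

      -- The constant 3 is the largest handicap difference, 2, plus the required gap of 1.
      factor : ((s,t , x,y) : Comparison) → _
      factor ((s , t) , (x , y)) = multiple-≥ (1# + 1# + 1#) (cost s t y - cost s t x)

      bound : ∃ λ k → ∀ c → proj₁ (factor c) ≤ k
      bound = upperBound (enum× (enum× (enumFin n₁) (enumFin n₃)) (enum× (enumFin 3) (enumFin 3)))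
                         (proj₁ ∘ factor)

      k : Carrier
      k = proj₁ bound

      -- The handicap goes to the source side only, so that each route carries it once.
      p′ : Fin n₁ → Fin 3 → Carrier
      p′ s x = k * p s x + handicap x

      q′ : Fin n₃ → Fin 3 → Carrier
      q′ t x = k * q t x

      cost′ : Fin n₁ → Fin n₃ → Fin 3 → Carrier
      cost′ s t x = p′ s x + q′ t x

      cost′-affine : ∀ s t x → cost′ s t x ≈ k * cost s t x + handicap x
      cost′-affine s t x = solve 4 (λ k a b e → (k :* a :+ e) :+ k :* b := k :* (a :+ b) :+ e)
        refl k (p s x) (q t x) (handicap x)

      affine-gap : ∀ s t x y → (k * cost s t x + handicap x) + 1# ≤ k * cost s t y + handicap y →
                   cost′ s t x + 1# ≤ cost′ s t y
      affine-gap s t x y gap = begin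
        cost′ s t x + 1#                      ≈⟨ +-congʳ (cost′-affine s t x) ⟩
        (k * cost s t x + handicap x) + 1#    ≤⟨ gap ⟩
        k * cost s t y + handicap y           ≈⟨ cost′-affine s t y ⟨
        cost′ s t y                           ∎
        where open ≤-Reasoning

      cost-strict : ∀ s t x y → cost s t x < cost s t y → cost′ s t x + 1# ≤ cost′ s t y
      cost-strict s t x y cx<cy = affine-gap s t x y (≤-transfer
        (+-mono-≤ (proj₂ (factor ((s , t) , (x , y))) (proj₂ bound _) (<⇒0<- cx<cy))
                  (+-mono-≤ (handicap≤2 x) (0≤handicap y)))
        (solve 6 (λ k c d e f i →
          (((i :+ i) :+ i) :+ (e :+ con (+ 0))) :+ (k :* d :+ f) :=
          (k :* (d :- c) :+ ((i :+ i) :+ f)) :+ ((k :* c :+ e) :+ i))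
          refl k (cost s t x) (cost s t y) (handicap x) (handicap y) 1#))

      cost-tie : ∀ s t x y → cost s t x ≈ cost s t y → handicap x + 1# ≤ handicap y →
                 cost′ s t x + 1# ≤ cost′ s t y
      cost-tie s t x y cx≈cy hx+1≤hy = affine-gap s t x y (≤-trans
        (≤-reflexive (+-assoc (k * cost s t x) (handicap x) 1#))
        (+-mono-≤ (≤-reflexive (*-congˡ cx≈cy)) hx+1≤hy))

      -- Unequal costs decide by the scaling, equal ones by the handicaps; so two distinct routes
      -- are never closer than 1.
      dichotomy : ∀ s t {x y} → x ≢ y →
                  cost′ s t x + 1# ≤ cost′ s t y ⊎ cost′ s t y + 1# ≤ cost′ s t x
      dichotomy s t {x} {y} x≢y with compare (cost s t x) (cost s t y) | ≢⇒pair x≢y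
      ... | inj₁ cx<cy        | _ = inj₁ (cost-strict s t x y cx<cy)
      ... | inj₂ (inj₂ cy<cx) | _ = inj₂ (cost-strict s t y x cy<cx)
      ... | inj₂ (inj₁ cx≈cy) | i , inj₁ (≡.refl , ≡.refl) =
        inj₁ (cost-tie s t x y cx≈cy (handicap-step i))
      ... | inj₂ (inj₁ cx≈cy) | i , inj₂ (≡.refl , ≡.refl) =
        inj₂ (cost-tie s t y x (sym cx≈cy) (handicap-step i))

      best : ∀ s t → ∃ λ x → ∀ y → cost′ s t x ≤ cost′ s t y
      best s t = minimiser (enumFin 3) zero (cost′ s t)

      win : Fin n₁ → Fin n₃ → Fin 3
      win s t = proj₁ (best s t)

      -- The perturbation preserves strict inequalities, so a minimiser of `cost′` also minimises
      -- `cost`.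
      cost-win : ∀ s t y → cost s t (win s t) ≤ cost s t y
      cost-win s t y = ≮⇒≥ λ cy<cx →
        x+1≰x (≤-trans (cost-strict s t y (win s t) cy<cx) (proj₂ (best s t) y))

      separates : Separates win p′ q′
      separates s t ≡.refl x≢y = fromInj₁
        (λ cy+1≤cx → contradiction (≤-trans cy+1≤cx (proj₂ (best s t) _)) x+1≰x)
        (dichotomy s t x≢y)

-- The three comparison graphs and their edge count

sum-splitAt : ∀ m {n} (f : Fin m ⊎ Fin n → ℕ) →
              sum (f ∘ splitAt m) ≡ sum (f ∘ inj₁) ℕ.+ sum (f ∘ inj₂)
sum-splitAt zero    f = ≡.refl
sum-splitAt (suc m) f = ≡.trans
  (≡.cong (f (inj₁ zero) ℕ.+_) (sum-splitAt m (f ∘ Sum.map₁ suc)))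
  (≡.sym (ℕ.+-assoc (f (inj₁ zero)) _ _))

sum-const : ∀ n k → sum {n} (λ _ → k) ≡ n ℕ.* k
sum-const zero    k = ≡.refl
sum-const (suc n) k = ≡.cong (k ℕ.+_) (sum-const n k)

∑∑-distrib-+ : ∀ {m n} (f g : Fin m → Fin n → ℕ) →
               sum (λ i → sum λ j → f i j ℕ.+ g i j) ≡ sum (λ i → sum (f i)) ℕ.+ sum (λ i → sum (g i))
∑∑-distrib-+ f g = ≡.trans (sum-cong-≗ λ i → ∑-distrib-+ (f i) (g i)) (∑-distrib-+ (sum ∘ f) (sum ∘ g))

module ComparisonGraphs {n₁ n₃ : ℕ} (win : Fin n₁ → Fin n₃ → Fin 3) where

  -- Each arc points the way in which the difference of potentials at `lo i` and `hi i` must grow: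
  -- towards the target if `lo i` wins, towards the source if `hi i` wins. If the third middle
  -- vertex wins, graph `i` imposes nothing on this pair.
  arc : Fin 3 → Digraph (Fin n₁ ⊎ Fin n₃)
  arc i (inj₁ s) (inj₂ t) = ⌊ win s t Fin.≟ lo i ⌋
  arc i (inj₂ t) (inj₁ s) = ⌊ win s t Fin.≟ hi i ⌋
  arc i (inj₁ _) (inj₁ _) = false
  arc i (inj₂ _) (inj₂ _) = false

  triple : Fin 3 → Digraph (Fin (n₁ ℕ.+ n₃))
  triple i u v = arc i (splitAt n₁ u) (splitAt n₁ v)

  arc⇒edge : ∀ i a b → T (arc i a b) → Edge (triple i) (join n₁ n₃ a) (join n₁ n₃ b)
  arc⇒edge i a b = ≡.subst T (≡.sym (≡.cong₂ (arc i) (Fin.splitAt-join n₁ n₃ a) (Fin.splitAt-join n₁ n₃ b)))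

  indicator : Bool → ℕ
  indicator b = if b then 1 else 0

  pairEdges : Fin 3 → Fin 3 → ℕ
  pairEdges i x = indicator ⌊ x Fin.≟ lo i ⌋ ℕ.+ indicator ⌊ x Fin.≟ hi i ⌋

  -- Each middle vertex lies in exactly two of the three pairs; hence the factor 2 in the edge
  -- count.
  pairEdges-total : ∀ x → pairEdges 0F x ℕ.+ pairEdges 1F x ℕ.+ pairEdges 2F x ≡ 2
  pairEdges-total 0F = ≡.refl
  pairEdges-total 1F = ≡.refl
  pairEdges-total 2F = ≡.refl

  -- Rows of sources count the wins of `lo i`, rows of targets those of `hi i`. Exchanging the order
  -- of summation for the targets puts both under one sum over pairs.
  numEdges-triple : ∀ i → numEdges (triple i) ≡ sum (λ s → sum λ t → pairEdges i (win s t))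
  numEdges-triple i = begin
    sum (row ∘ splitAt n₁)                            ≡⟨ sum-splitAt n₁ row ⟩
    sum (row ∘ inj₁) ℕ.+ sum (row ∘ inj₂)             ≡⟨ ≡.cong₂ ℕ._+_ (sum-cong-≗ row₁) (sum-cong-≗ row₂) ⟩
    sum (λ s → sum (forward s)) ℕ.+ sum (λ t → sum λ s → backward s t)
                                                      ≡⟨ ≡.cong (sum (λ s → sum (forward s)) ℕ.+_) (∑-comm backward) ⟨
    sum (λ s → sum (forward s)) ℕ.+ sum (λ s → sum (backward s))
                                                      ≡⟨ ∑∑-distrib-+ forward backward ⟨
    sum (λ s → sum λ t → pairEdges i (win s t))       ∎
    where
    open ≡.≡-Reasoning

    row : Fin n₁ ⊎ Fin n₃ → ℕ
    row a = sum λ v → indicator (arc i a (splitAt n₁ v))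

    forward backward : Fin n₁ → Fin n₃ → ℕ
    forward  s t = indicator ⌊ win s t Fin.≟ lo i ⌋
    backward s t = indicator ⌊ win s t Fin.≟ hi i ⌋

    row₁ : ∀ s → row (inj₁ s) ≡ sum (forward s)
    row₁ s = ≡.trans (sum-splitAt n₁ (indicator ∘ arc i (inj₁ s)))
                     (≡.cong (ℕ._+ sum (forward s)) (sum-replicate-zero n₁))

    row₂ : ∀ t → row (inj₂ t) ≡ sum (λ s → backward s t)
    row₂ t = ≡.trans (sum-splitAt n₁ (indicator ∘ arc i (inj₂ t)))
                     (≡.trans (≡.cong (sum (λ s → backward s t) ℕ.+_) (sum-replicate-zero n₃)) (ℕ.+-identityʳ _))

  numEdges-total : numEdges (triple 0F) ℕ.+ numEdges (triple 1F) ℕ.+ numEdges (triple 2F) ≡ 2 ℕ.* n₁ ℕ.* n₃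
  numEdges-total = begin
    numEdges (triple 0F) ℕ.+ numEdges (triple 1F) ℕ.+ numEdges (triple 2F)
      ≡⟨ ≡.cong₂ ℕ._+_ (≡.cong₂ ℕ._+_ (numEdges-triple 0F) (numEdges-triple 1F)) (numEdges-triple 2F) ⟩
    ∑∑ (edges 0F) ℕ.+ ∑∑ (edges 1F) ℕ.+ ∑∑ (edges 2F)
      ≡⟨ ≡.cong (ℕ._+ ∑∑ (edges 2F)) (∑∑-distrib-+ (edges 0F) (edges 1F)) ⟨
    ∑∑ (λ s t → edges 0F s t ℕ.+ edges 1F s t) ℕ.+ ∑∑ (edges 2F)
      ≡⟨ ∑∑-distrib-+ (λ s t → edges 0F s t ℕ.+ edges 1F s t) (edges 2F) ⟨
    ∑∑ (λ s t → edges 0F s t ℕ.+ edges 1F s t ℕ.+ edges 2F s t)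
      ≡⟨ sum-cong-≗ (λ s → ≡.trans (sum-cong-≗ λ t → pairEdges-total (win s t)) (sum-const n₃ 2)) ⟩
    sum {n₁} (λ _ → n₃ ℕ.* 2)   ≡⟨ sum-const n₁ (n₃ ℕ.* 2) ⟩
    n₁ ℕ.* (n₃ ℕ.* 2)           ≡⟨ ℕ.*-assoc n₁ n₃ 2 ⟨
    n₁ ℕ.* n₃ ℕ.* 2             ≡⟨ ℕ.*-comm (n₁ ℕ.* n₃) 2 ⟩
    2 ℕ.* (n₁ ℕ.* n₃)           ≡⟨ ℕ.*-assoc 2 n₁ n₃ ⟨
    2 ℕ.* n₁ ℕ.* n₃             ∎
    where
    open ≡.≡-Reasoning

    ∑∑ : (Fin n₁ → Fin n₃ → ℕ) → ℕ
    ∑∑ f = sum λ s → sum (f s)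

    edges : Fin 3 → Fin n₁ → Fin n₃ → ℕ
    edges i s t = pairEdges i (win s t)

-- Order preservers, potentials and normalised costs

module OrderPreservers (ℝ : Reals) where
  open OrderedField ℝ
  open Extrema ℝ

  -- Around a cycle `h` would exceed its own starting value by at least 1.
  topological⇒acyclic : ∀ {V} (G : Digraph V) h → IsTopologicalOrdering ℝ G h → IsAcyclic G
  topological⇒acyclic G h topological v cycle = x+1≰x (ascends cycle)
    where
    ascends : ∀ {u v} → TransClosure (Edge G) u v → h u + 1# ≤ h v
    ascends [ e ]   = topological _ _ e
    ascends (_∷_ {u} {v} {w} e es) = begin
      h u + 1#   ≤⟨ topological _ _ e ⟩
      h v        ≈⟨ +-identityʳ (h v) ⟨
      h v + 0#   ≤⟨ +-mono-≤ ≤-refl 0≤1 ⟩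
      h v + 1#   ≤⟨ ascends es ⟩
      h w        ∎
      where open ≤-Reasoning

  range : ∀ {V} → Enumerable V → V → (h : Fin 3 → V → Carrier) → ∃ (IsRange ℝ h)
  range enumV v h = proj₁ largest , spread , spread-h , proj₂ largest
    where
    highest : ∀ i → ∃ (IsMaximum ℝ (h i))
    highest i = maximum enumV v (h i)

    lowest : ∀ i → ∃ (IsMinimum ℝ (h i))
    lowest i = minimum enumV v (h i)

    spread : Fin 3 → Carrier
    spread i = proj₁ (highest i) - proj₁ (lowest i)

    spread-h : ∀ i → IsSpread ℝ (h i) (spread i)
    spread-h i = _ , _ , proj₂ (highest i) , proj₂ (lowest i) , refl

    largest : ∃ (IsMaximum ℝ spread)
    largest = maximum (enumFin 3) zero spread

  difference≤range : ∀ {V} {h : Fin 3 → V → Carrier} {r} → IsRange ℝ h r →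
                     ∀ i u v → h i u - h i v ≤ r
  difference≤range {h = h} (spread , isSpread , _ , spread≤r) i u v
    with M , m , (_ , h≤M) , (_ , m≤h) , spread≈M-m ← isSpread i
    = ≤-trans (≤-transfer (+-mono-≤ (h≤M u) (m≤h v))
        (solve 4 (λ a b M m → (a :+ m) :+ (M :- m) := (M :+ b) :+ (a :- b)) refl (h i u) (h i v) M m))
      (≤-trans (≤-reflexive (sym spread≈M-m)) (spread≤r i))

  0≤range : ∀ {V} {h : Fin 3 → V → Carrier} {r} → V → IsRange ℝ h r → 0# ≤ r
  0≤range {h = h} v isRange = ≤-trans
    (≤-reflexive (solve 1 (λ a → con (+ 0) := a :- a) refl (h zero v)))
    (difference≤range isRange zero v v)

  -- The lower end makes weights positive; the upper end is the bound claimed for them.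
  Normal : Carrier → Carrier → Set
  Normal r c = 1# ≤ c × c ≤ 1# + r

  normalise : ∀ {r} (f : Fin 3 → Carrier) → (∀ x y → f x - f y ≤ r) →
              ∃ λ g → (∀ x y → g x - g y ≈ f x - f y) × (∀ x → Normal r (g x))
  normalise {r} f f-f≤r =
    (λ x → (f x - f m) + 1#) ,
    (λ x y → solve 4 (λ a b c i → ((a :- c) :+ i) :- ((b :- c) :+ i) := a :- b) refl (f x) (f y) (f m) 1#) ,
    λ x → ≤-transfer (proj₂ best x)
            (solve 3 (λ a c i → c :+ ((a :- c) :+ i) := a :+ i) refl (f x) (f m) 1#) ,
          ≤-transfer (f-f≤r x m)
            (solve 4 (λ a c i r → (a :- c) :+ (i :+ r) := r :+ ((a :- c) :+ i)) refl (f x) (f m) 1# r)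
    where
    best : ∃ λ m → ∀ x → f m ≤ f x
    best = minimiser (enumFin 3) zero f

    m : Fin 3
    m = proj₁ best

  module _ {n₁ n₃ : ℕ} (win : Fin n₁ → Fin n₃ → Fin 3) where
    open ComparisonGraphs win
    open Separation ℝ {n₁} {n₃}

    Endpoint : Set
    Endpoint = Fin n₁ ⊎ Fin n₃

    -- `Separates` rearranged to have the source on one side and the target on the other, with `ψ`
    -- equal to `p` at sources and to the negative of `q` at targets.
    Separating : (Endpoint → Fin 3 → Carrier) → Set
    Separating ψ = ∀ s t {x y} → win s t ≡ x → x ≢ y →
      (ψ (inj₁ s) x - ψ (inj₁ s) y) + 1# ≤ ψ (inj₂ t) x - ψ (inj₂ t) y

    differences : (Endpoint → Fin 3 → Carrier) → Fin 3 → Fin (n₁ ℕ.+ n₃) → Carrier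
    differences ψ i v = ψ (splitAt n₁ v) (lo i) - ψ (splitAt n₁ v) (hi i)

    -- Exchanging the two middle vertices reverses the comparison.
    +1-flip : ∀ {a b c d} → (a - b) + 1# ≤ c - d → (d - c) + 1# ≤ b - a
    +1-flip {a} {b} {c} {d} a-b+1≤c-d = ≤-transfer a-b+1≤c-d
      (solve 5 (λ a b c d i → ((a :- b) :+ i) :+ (b :- a) := (c :- d) :+ ((d :- c) :+ i)) refl a b c d 1#)

    -- Additivity is telescoping over the middle vertices 0, 1, 2. Arcs leaving a target come from
    -- the same inequality with the pair exchanged.
    separating⇒preserver : ∀ ψ → Separating ψ → IsOrderPreserver ℝ triple (differences ψ)
    separating⇒preserver ψ separating = (λ i u v → ascends i (splitAt n₁ u) (splitAt n₁ v)) , additive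
      where
      ascends : ∀ i a b → T (arc i a b) → (ψ a (lo i) - ψ a (hi i)) + 1# ≤ ψ b (lo i) - ψ b (hi i)
      ascends i (inj₁ s) (inj₂ t) e = separating s t (toWitness e) (lo≢hi i)
      ascends i (inj₂ t) (inj₁ s) e = +1-flip (separating s t (toWitness e) (lo≢hi i ∘ ≡.sym))

      additive : ∀ v → differences ψ 0F v + differences ψ 1F v ≈ differences ψ 2F v
      additive v = solve 3 (λ a b c → (a :- b) :+ (b :- c) := a :- c) refl (φ 0F) (φ 1F) (φ 2F)
        where φ = ψ (splitAt n₁ v)

    separates⇒separating : ∀ {p q} → Separates win p q →
                           Separating Sum.[ p , (λ t x → - q t x) ]
    separates⇒separating {p} {q} separates s t {x} {y} win≡x x≢y = ≤-transfer
      (separates s t win≡x x≢y)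
      (solve 5 (λ a b c d i → (a :+ b :+ i) :+ (:- b :- :- d) := (c :+ d) :+ ((a :- c) :+ i))
        refl (p s x) (q t x) (p s y) (q t y) 1#)

    module _ {h : Fin 3 → Fin (n₁ ℕ.+ n₃) → Carrier} (preserver : IsOrderPreserver ℝ triple h) where

      -- Differences fix a potential up to one constant per endpoint, chosen here to make it vanish
      -- at `2F`. Then `h 2F` and `h 1F` are its other values, and additivity recovers `h 0F`.
      potential : Endpoint → Fin 3 → Carrier
      potential a 0F = h 2F (join n₁ n₃ a)
      potential a 1F = h 1F (join n₁ n₃ a)
      potential a 2F = 0#

      potential-difference : ∀ i a → h i (join n₁ n₃ a) ≈ potential a (lo i) - potential a (hi i)
      potential-difference 0F a = trans
        (solve 2 (λ x y → x := (x :+ y) :- y) refl (h 0F v) (h 1F v)) (+-congʳ (proj₂ preserver v))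
        where v = join n₁ n₃ a
      potential-difference 1F a = solve 1 (λ x → x := x :- con (+ 0)) refl _
      potential-difference 2F a = solve 1 (λ x → x := x :- con (+ 0)) refl _

      arc⇒ascends : ∀ i a b → T (arc i a b) →
        (potential a (lo i) - potential a (hi i)) + 1# ≤ potential b (lo i) - potential b (hi i)
      arc⇒ascends i a b e = begin
        (potential a (lo i) - potential a (hi i)) + 1#   ≈⟨ +-congʳ (potential-difference i a) ⟨
        h i (join n₁ n₃ a) + 1#                          ≤⟨ proj₁ preserver i _ _ (arc⇒edge i a b e) ⟩
        h i (join n₁ n₃ b)                               ≈⟨ potential-difference i b ⟩
        potential b (lo i) - potential b (hi i)          ∎
        where open ≤-Reasoning

      preserver⇒separating : Separating potential
      preserver⇒separating s t win≡x x≢y with ≢⇒pair x≢y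
      ... | i , inj₁ (≡.refl , ≡.refl) = arc⇒ascends i (inj₁ s) (inj₂ t) (fromWitness win≡x)
      ... | i , inj₂ (≡.refl , ≡.refl) = +1-flip (arc⇒ascends i (inj₂ t) (inj₁ s) (fromWitness win≡x))

      -- For `x` and `y` distinct, the left side is a difference of two values of a single ordering;
      -- listing the pair in reverse exchanges the roles of `a` and `b`.
      potential≤range : ∀ {r} → IsRange ℝ h r → ∀ a b x y →
        (potential a x - potential a y) - (potential b x - potential b y) ≤ r
      potential≤range {r} isRange a b x y with x Fin.≟ y
      ... | yes ≡.refl = ≤-trans
        (≤-reflexive (solve 2 (λ f g → (f :- f) :- (g :- g) := con (+ 0)) refl (potential a x) (potential b x)))
        (0≤range (join n₁ n₃ a) isRange)
      ... | no x≢y with ≢⇒pair x≢y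
      ... | i , inj₁ (≡.refl , ≡.refl) = ≤-trans
        (≤-reflexive (+-cong (sym (potential-difference i a)) (-‿cong (sym (potential-difference i b)))))
        (difference≤range isRange i (join n₁ n₃ a) (join n₁ n₃ b))
      ... | i , inj₂ (≡.refl , ≡.refl) = ≤-trans
        (≤-reflexive (trans
          (solve 4 (λ a b c d → (b :- a) :- (d :- c) := (c :- d) :- (a :- b)) refl
            (potential a (lo i)) (potential a (hi i)) (potential b (lo i)) (potential b (hi i)))
          (+-cong (sym (potential-difference i b)) (-‿cong (sym (potential-difference i a))))))
        (difference≤range isRange i (join n₁ n₃ b) (join n₁ n₃ a))

      -- Only differences between middle vertices matter, so every potential may be
      -- taken relative to that of a base vertex and shifted to have minimum 1.
      normalCosts : ∀ {r} → IsRange ℝ h r → Endpoint → ∃[ p ] ∃[ q ]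
        Separates win p q × (∀ s x → Normal r (p s x)) × (∀ t x → Normal r (q t x))
      normalCosts {r} isRange base =
        p , q , separates , (λ s → proj₂ (proj₂ (source s))) , (λ t → proj₂ (proj₂ (target t)))
        where
        relative : Endpoint → Endpoint → Fin 3 → Carrier
        relative a b x = potential a x - potential b x

        relative≤range : ∀ a b x y → relative a b x - relative a b y ≤ r
        relative≤range a b x y = ≤-trans
          (≤-reflexive (solve 4 (λ a b c d → (a :- b) :- (c :- d) := (a :- c) :- (b :- d)) refl
            (potential a x) (potential b x) (potential a y) (potential b y)))
          (potential≤range isRange a b x y)

        source : ∀ s → _
        source s = normalise (relative (inj₁ s) base) (relative≤range (inj₁ s) base)

        -- The base comes first here because target costs are negated potentials.
        target : ∀ t → _
        target t = normalise (relative base (inj₂ t)) (relative≤range base (inj₂ t))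

        p : Fin n₁ → Fin 3 → Carrier
        p s = proj₁ (source s)

        q : Fin n₃ → Fin 3 → Carrier
        q t = proj₁ (target t)

        separates : Separates win p q
        -- Only differences between `x` and `y` occur: the normalising shifts drop out, and the base
        -- potential cancels between source and target.
        separates s t {x} {y} win≡x x≢y = ≤-transfer (preserver⇒separating s t win≡x x≢y) (begin
          ((σ x - σ y) + 1#) + (p s y + q t y)
            ≈⟨ solve 8 (λ a b c d e f i z →
                 ((a :- b) :+ i) :+ z :=
                 (((a :- c) :- (b :- d)) :+ ((c :- e) :- (d :- f))) :+ (((e :- f) :+ i) :+ z))
                 refl (σ x) (σ y) (β x) (β y) (τ x) (τ y) 1# (p s y + q t y) ⟩
          (((σ x - β x) - (σ y - β y)) + ((β x - τ x) - (β y - τ y))) + (((τ x - τ y) + 1#) + (p s y + q t y))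
            ≈⟨ +-congʳ (+-cong (proj₁ (proj₂ (source s)) x y) (proj₁ (proj₂ (target t)) x y)) ⟨
          ((p s x - p s y) + (q t x - q t y)) + (((τ x - τ y) + 1#) + (p s y + q t y))
            ≈⟨ solve 6 (λ a b c d e i →
                 ((a :- b) :+ (c :- d)) :+ ((e :+ i) :+ (b :+ d)) := e :+ ((a :+ c) :+ i))
                 refl (p s x) (p s y) (q t x) (q t y) (τ x - τ y) 1# ⟩
          (τ x - τ y) + ((p s x + q t x) + 1#)
            ∎)
          where
          open import Relation.Binary.Reasoning.Setoid setoid
          σ = potential (inj₁ s)
          β = potential base
          τ = potential (inj₂ t)

    additiveTriple : ∀ {p q} → Separates win p q → IsAdditiveTriple ℝ triple
    additiveTriple {p} {q} separates =
      (λ i → topological⇒acyclic (triple i) _ (proj₁ preserver i)) , _ , preserver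
      where preserver = separating⇒preserver Sum.[ p , (λ t x → - q t x) ] (separates⇒separating separates)

-- Paths in the layered graph and the gap-1 preserver

module ThreeLayered (ℝ : Reals) {n₁ n₃ : ℕ} (G : Digraph (LayeredVertex n₁ 3 n₃))
                    (layered : IsThreeLayered G) where
  open OrderedField ℝ
  open Extrema ℝ
  open Separation ℝ {n₁} {n₃}

  -- The layers limit paths to two edges. `one` records its layers so that its endpoints can be told
  -- from those of the other two shapes.
  data PathView : ∀ {u v} → Path G u v → Set where
    none : ∀ {u} → PathView (ε {x = u})
    one  : ∀ {u v} → ConsecutiveLayers u v → (e : Edge G u v) → PathView (e ◅ ε)
    two  : ∀ {s x t} (e : Edge G (in₁ s) (in₂ x)) (e′ : Edge G (in₂ x) (in₃ t)) → PathView (e ◅ e′ ◅ ε)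

  pathView : ∀ {u v} (π : Path G u v) → PathView π
  pathView ε       = none
  pathView (e ◅ ε) = one (layered _ _ e) e
  pathView (e ◅ e′ ◅ π) with layered _ _ e | layered _ _ e′ | π
  ... | 1→2 | 2→3 | ε      = two e e′
  ... | 1→2 | 2→3 | e″ ◅ _ with () ← layered _ _ e″

  -- Between fixed endpoints the only freedom is the middle vertex of a route.
  data Parallel : ∀ {u v} → Path G u v → Path G u v → Set where
    same   : ∀ {u v} {π : Path G u v} → Parallel π π
    routes : ∀ {s t x y} (e : Edge G (in₁ s) (in₂ x)) (e′ : Edge G (in₂ x) (in₃ t))
                         (f : Edge G (in₁ s) (in₂ y)) (f′ : Edge G (in₂ y) (in₃ t)) →
                         Parallel (e ◅ e′ ◅ ε) (f ◅ f′ ◅ ε)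

  parallel : ∀ {u v} (π π′ : Path G u v) → Parallel π π′
  parallel π π′ with pathView π | pathView π′
  ... | none     | none      = same
  ... | one _ e  | one _ f   with ≡.refl ← T-irrelevant e f = same
  ... | two e e′ | two f f′  = routes e e′ f f′
  ... | none     | one () _
  ... | one () _ | none
  ... | one () _ | two _ _
  ... | two _ _  | one () _

  module _ (p : Fin n₁ → Fin 3 → Carrier) (q : Fin n₃ → Fin 3 → Carrier) where

    -- The value 1# is never used, as G has no edges between other pairs of layers.
    costWeighting : Weighting ℝ G
    costWeighting ((in₁ s , in₂ x) , _) = p s x
    costWeighting ((in₂ x , in₃ t) , _) = q t x
    costWeighting _                     = 1#

    costWeighting-all : (P : Carrier → Set) → (∀ s x → P (p s x)) → (∀ t x → P (q t x)) →
                        ∀ e → P (costWeighting e)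
    costWeighting-all P Pp Pq ((u , v) , e) with layered u v e
    ... | 1→2 = Pp _ _
    ... | 2→3 = Pq _ _

  module _ (w : Weighting ℝ G) (w-positive : IsPositive ℝ G w) (edge : EdgeSet G) where

    enumEdges : Enumerable (EdgeSet G)
    enumEdges = enumEdgeSet G (enumLayeredVertex n₁ 3 n₃)

    bound : ∃ λ b → ∀ e → w e ≤ b
    bound = upperBound enumEdges w

    -- No shorter than any route of two edges.
    penalty : Carrier
    penalty = proj₁ bound + proj₁ bound

    0<penalty : 0# < penalty
    0<penalty = 0<x+y 0<bound (proj₁ 0<bound)
      where
      0<bound : 0# < proj₁ bound
      0<bound = <-≤-trans (w-positive edge) (proj₂ bound edge)

    extend : LayeredVertex n₁ 3 n₃ → LayeredVertex n₁ 3 n₃ → Carrier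
    extend u v with T? (G u v)
    ... | yes e = w ((u , v) , e)
    ... | no  _ = penalty

    extend-edge : ∀ {u v} (e : Edge G u v) → extend u v ≡ w ((u , v) , e)
    extend-edge {u} {v} e with T? (G u v)
    ... | yes e′ = ≡.cong (λ e → w ((u , v) , e)) (T-irrelevant e′ e)
    ... | no  ¬e = contradiction e ¬e

    extend-nonedge : ∀ {u v} → ¬ Edge G u v → extend u v ≡ penalty
    extend-nonedge {u} {v} ¬e with T? (G u v)
    ... | yes e = contradiction e ¬e
    ... | no  _ = ≡.refl

    0<extend : ∀ u v → 0# < extend u v
    0<extend u v with T? (G u v)
    ... | yes e = w-positive _
    ... | no  _ = 0<penalty

    sourceCost : Fin n₁ → Fin 3 → Carrier
    sourceCost s x = extend (in₁ s) (in₂ x)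

    targetCost : Fin n₃ → Fin 3 → Carrier
    targetCost t x = extend (in₂ x) (in₃ t)

    routeCost : Fin n₁ → Fin n₃ → Fin 3 → Carrier
    routeCost = cost sourceCost targetCost

    routeCost-edges : ∀ {s t x} (e : Edge G (in₁ s) (in₂ x)) (e′ : Edge G (in₂ x) (in₃ t)) →
                      routeCost s t x ≡ w (_ , e) + w (_ , e′)
    routeCost-edges e e′ = ≡.cong₂ _+_ (extend-edge e) (extend-edge e′)

    -- A missing edge costs `penalty`, and the other half of the route adds something strictly
    -- positive.
    routeCost≤penalty⇒edges : ∀ {s t x} → routeCost s t x ≤ penalty →
                              Edge G (in₁ s) (in₂ x) × Edge G (in₂ x) (in₃ t)
    routeCost≤penalty⇒edges {s} {t} {x} cheap =
      decidable-stable (T? _) (λ ¬e → exceeds targetCost-positive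
        (≤-trans (≤-reflexive (trans (+-comm (targetCost t x) penalty)
                                     (+-congʳ (reflexive (≡.sym (extend-nonedge ¬e)))))) cheap)) ,
      decidable-stable (T? _) (λ ¬e′ → exceeds (0<extend (in₁ s) (in₂ x))
        (≤-trans (≤-reflexive (+-congˡ (reflexive (≡.sym (extend-nonedge ¬e′))))) cheap))
      where
      targetCost-positive : 0# < targetCost t x
      targetCost-positive = 0<extend (in₂ x) (in₃ t)

      exceeds : ∀ {c} → 0# < c → ¬ (c + penalty ≤ penalty)
      exceeds {c} 0<c c+penalty≤penalty = ≤⇒≯ (≤-transfer c+penalty≤penalty
        (solve 2 (λ c z → (c :+ z) :+ con (+ 0) := z :+ c) refl c penalty)) 0<c

    module _ {win : Fin n₁ → Fin n₃ → Fin 3}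
             (win-cheapest : ∀ s t y → routeCost s t (win s t) ≤ routeCost s t y)
             {p : Fin n₁ → Fin 3 → Carrier} {q : Fin n₃ → Fin 3 → Carrier}
             (separates : Separates win p q) where

      w′ : Weighting ℝ G
      w′ = costWeighting p q

      -- An existing route costs at most `penalty`, so the cheapest one does too and must also exist
      -- in `G`.
      win-edges : ∀ {s t x} → Edge G (in₁ s) (in₂ x) → Edge G (in₂ x) (in₃ t) →
                  Edge G (in₁ s) (in₂ (win s t)) × Edge G (in₂ (win s t)) (in₃ t)
      win-edges {s} {t} {x} e e′ = routeCost≤penalty⇒edges (begin
        routeCost s t (win s t)      ≤⟨ win-cheapest s t x ⟩
        routeCost s t x              ≡⟨ routeCost-edges e e′ ⟩
        w (_ , e) + w (_ , e′)       ≤⟨ +-mono-≤ (proj₂ bound _) (proj₂ bound _) ⟩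
        penalty                      ∎)
        where open ≤-Reasoning

      -- The summands `0#` are the weights of the empty path at which `weight` ends.
      route-gap : ∀ {s t x y} → win s t ≡ x → x ≢ y → (p s x + (q t x + 0#)) + 1# ≤ p s y + (q t y + 0#)
      route-gap {s} {t} {x} {y} win≡x x≢y = begin
        (p s x + (q t x + 0#)) + 1#     ≈⟨ +-congʳ (+-congˡ (+-identityʳ (q t x))) ⟩
        (p s x + q t x) + 1#            ≤⟨ separates s t win≡x x≢y ⟩
        p s y + q t y                   ≈⟨ +-congˡ (+-identityʳ (q t y)) ⟨
        p s y + (q t y + 0#)            ∎
        where open ≤-Reasoning

      -- Otherwise the winning route, which exists in `G`, would be shorter by at least 1.
      shortest⇒win : ∀ {s t x} (e : Edge G (in₁ s) (in₂ x)) (e′ : Edge G (in₂ x) (in₃ t)) →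
                     IsShortest ℝ G w′ (e ◅ e′ ◅ ε) → win s t ≡ x
      shortest⇒win {s} {t} {x} e e′ shortest = decidable-stable (win s t Fin.≟ x) λ win≢x →
        let d , d′ = win-edges e e′
        in x+1≰x (≤-trans (route-gap ≡.refl win≢x) (shortest (d ◅ d′ ◅ ε)))

      win-route≤ : ∀ {s t x y}
        (e : Edge G (in₁ s) (in₂ x)) (e′ : Edge G (in₂ x) (in₃ t))
        (f : Edge G (in₁ s) (in₂ y)) (f′ : Edge G (in₂ y) (in₃ t)) →
        win s t ≡ x → w (_ , e) + (w (_ , e′) + 0#) ≤ w (_ , f) + (w (_ , f′) + 0#)
      win-route≤ {s} {t} {x} {y} e e′ f f′ ≡.refl = begin
        w (_ , e) + (w (_ , e′) + 0#)   ≈⟨ +-congˡ (+-identityʳ _) ⟩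
        w (_ , e) + w (_ , e′)          ≡⟨ routeCost-edges e e′ ⟨
        routeCost s t x                 ≤⟨ win-cheapest s t y ⟩
        routeCost s t y                 ≡⟨ routeCost-edges f f′ ⟩
        w (_ , f) + w (_ , f′)          ≈⟨ +-congˡ (+-identityʳ _) ⟨
        w (_ , f) + (w (_ , f′) + 0#)   ∎
        where open ≤-Reasoning

      preserves : ∀ {u v} (π : Path G u v) → IsShortest ℝ G w′ π → IsShortest ℝ G w π
      preserves π shortest π′ with parallel π π′
      ... | same             = ≤-refl
      ... | routes e e′ f f′ = win-route≤ e e′ f f′ (shortest⇒win e e′ shortest)

      gap : ∀ {u v} (π π′ : Path G u v) → IsShortest ℝ G w′ π → ¬ IsShortest ℝ G w′ π′ →
            weight ℝ G w′ π + 1# ≤ weight ℝ G w′ π′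
      gap π π′ shortest ¬shortest with parallel π π′
      ... | same = contradiction shortest ¬shortest
      -- Equal middle vertices would make the two routes the same path, edge proofs being unique.
      ... | routes e e′ f f′ = route-gap (shortest⇒win e e′ shortest) λ where
        ≡.refl → ¬shortest (≡.subst₂ (λ f f′ → IsShortest ℝ G w′ (f ◅ f′ ◅ ε))
                                     (T-irrelevant e f) (T-irrelevant e′ f′) shortest)

      isGap1Preserver : (∀ s x → 1# ≤ p s x) → (∀ t x → 1# ≤ q t x) → IsGap1Preserver ℝ G w w′
      isGap1Preserver 1≤p 1≤q = record
        { positive  = costWeighting-all p q (0# <_) (λ s x → 1≤⇒0< (1≤p s x)) (λ t x → 1≤⇒0< (1≤q t x))
        ; preserves = preserves
        ; gap       = gap
        }

      maxWeight≤ : ∀ {r} → (∀ s x → OrderPreservers.Normal ℝ r (p s x)) →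
                   (∀ t x → OrderPreservers.Normal ℝ r (q t x)) →
                   ∃ λ x → PreserverMaxWeight ℝ G w x × x ≤ 1# + r
      maxWeight≤ {r} p-normal q-normal
        with e , w′≤w′e ← maximiser enumEdges edge w′ =
        w′ e ,
        (w′ , isGap1Preserver (λ s x → proj₁ (p-normal s x)) (λ t x → proj₁ (q-normal t x)) ,
         (e , refl) , w′≤w′e) ,
        costWeighting-all p q (_≤ 1# + r) (λ s x → proj₂ (p-normal s x)) (λ t x → proj₂ (q-normal t x)) e

    -- Each order preserver of range `r` yields a gap-1 preserver with weights at most `1# + r`.
    -- Additivity of the triple supplies at least one order preserver, and 0 bounds both sets from
    -- below.
    infima : ∀ {win : Fin n₁ → Fin n₃ → Fin 3} → (∀ s t y → routeCost s t (win s t) ≤ routeCost s t y) →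
             let open ComparisonGraphs win in
             IsAdditiveTriple ℝ triple → Fin n₁ ⊎ Fin n₃ →
             ∃[ a ] ∃[ b ] IsInf ℝ (PreserverMaxWeight ℝ G w) a ×
                           IsInf ℝ (OrderPreserverRange ℝ triple) b × a ≤ 1# + b
    infima {win} win-cheapest (_ , h , h-preserver) base = infimum-≤ 1#
      (range-h , h , h-preserver , proj₂ (range (enumFin _) vertex h))
      (0# , λ x (w′ , preserver , _ , w′≤x) →
        ≤-trans (proj₁ (IsGap1Preserver.positive preserver edge)) (w′≤x edge))
      (0# , λ r (_ , _ , isRange) → 0≤range vertex isRange)
      λ r (h , preserver , isRange) →
        let _ , _ , separates , p-normal , q-normal = normalCosts win preserver isRange base
        in maxWeight≤ win-cheapest separates p-normal q-normal
      where
      open OrderPreservers ℝ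

      vertex : Fin (n₁ ℕ.+ n₃)
      vertex = join n₁ n₃ base

      range-h : Carrier
      range-h = proj₁ (range (enumFin _) vertex h)

open import Data.Nat.Base using (_+_; _*_)

theorem1p14 : (ℝ : Reals) (n₁ n₂ n₃ : ℕ)
    (G : Digraph (LayeredVertex n₁ n₂ n₃)) (w : Weighting ℝ G) →
    IsThreeLayered G →
    IsPositive ℝ G w →
    n₂ ≡ 3 →
    Fin n₁ ⊎ Fin n₃ →
    EdgeSet G →
    ∃[ m ] Σ[ G* ∈ (Fin 3 → Digraph (Fin m)) ]
    IsAdditiveTriple ℝ G* ×
    m ≡ n₁ + n₃ ×
    numEdges (G* zero) + numEdges (G* (suc zero)) + numEdges (G* (suc (suc zero)))
    ≡ 2 * n₁ * n₃ ×
    (∃[ a ] ∃[ b ]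
    IsInf ℝ (PreserverMaxWeight ℝ G w) a ×
    IsInf ℝ (OrderPreserverRange ℝ G*) b ×
    Reals._≤_ ℝ a (Reals._+_ ℝ (Reals.1# ℝ) b))
theorem1p14 ℝ n₁ _ n₃ G w layered positive ≡.refl base edge =
  let open ThreeLayered ℝ G layered
      -- The separating costs serve to show the triple additive; the bounded weights are built from
      -- its orderings instead.
      win , _ , _ , win-cheapest , separates = Separation.separate ℝ
        (sourceCost w positive edge) (targetCost w positive edge)
      open ComparisonGraphs win
      additive = OrderPreservers.additiveTriple ℝ win separates
  in n₁ + n₃ , triple , additive , ≡.refl , numEdges-total ,
     infima w positive edge win-cheapest additive base
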